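{- For every even $d\ge2$ there exist, for every $n$, $n$-vertex $d$-hypercuts over $\mathbb{F}_2$ with $\binom{n}{d+1}\left(1-o_n(1)\right)$ $d$-faces.
   Context: Over $\mathbb{F}_2$, let $\partial_d$ be the matrix with rows indexed by $\binom{[n]}{d}$ and columns by $\binom{[n]}{d+1}$, the column of a $(d+1)$-set $\sigma$ ($d$-face) being the indicator vector of its $d+1$ subsets of size $d$. A set of $d$-faces is acyclic if its columns are linearly independent over $\mathbb{F}_2$; a $d$-hypertree is a maximal acyclic set of $d$-faces. A $d$-hypercut is an inclusion-minimal set of $d$-faces meeting every $d$-hypertree. $o_n(1)$ denotes a quantity tending to $0$ as $n\to\infty$. -}

module Defs where

open import Data.Nat using (ℕ; suc; _+_)
open import Data.Nat.Divisibility using (_∣_)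
open import Data.Fin.Subset using (Subset; ∣_∣; _⊆_)
open import Data.Fin.Subset.Properties using (_⊆?_)
open import Data.List using (List; []; _∷_; length; filter)
open import Data.List.Membership.Propositional using (_∈_; _∉_)
open import Data.List.Relation.Unary.All using (All)
open import Data.List.Relation.Unary.Any using (Any)
open import Data.List.Relation.Unary.Unique.Propositional using (Unique)
open import Data.Product using (Σ; _×_)
open import Relation.Binary.PropositionalEquality using (_≡_; _≢_)
open import Relation.Nullary using (¬_)

IsFace : (d : ℕ) {n : ℕ} → Subset n → Set
IsFace d σ = ∣ σ ∣ ≡ suc d

IsFaceSet : (d : ℕ) {n : ℕ} → List (Subset n) → Set
IsFaceSet d L = Unique L × All (IsFace d) L

_⊆ₗ_ : {n : ℕ} → List (Subset n) → List (Subset n) → Set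
S ⊆ₗ L = ∀ {x} → x ∈ S → x ∈ L

-- The F₂-sum of the columns of ∂_d indexed by S vanishes: for every
-- row τ (a d-subset), the number of σ ∈ S containing τ is even.
ZeroSum : (d : ℕ) {n : ℕ} → List (Subset n) → Set
ZeroSum d {n} S = (τ : Subset n) → ∣ τ ∣ ≡ d → 2 ∣ length (filter (τ ⊆?_) S)

-- Acyclic: the columns of ∂_d indexed by L are linearly independent over F₂,
-- i.e. no nonempty subcollection has zero sum.
Acyclic : (d : ℕ) {n : ℕ} → List (Subset n) → Set
Acyclic d L = (S : List _) → Unique S → S ⊆ₗ L → S ≢ [] → ¬ ZeroSum d S

IsHypertree : (d : ℕ) {n : ℕ} → List (Subset n) → Set
IsHypertree d {n} T =
  IsFaceSet d T × Acyclic d T ×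
  ((σ : Subset n) → IsFace d σ → σ ∉ T → ¬ Acyclic d (σ ∷ T))

MeetsAllHypertrees : (d : ℕ) {n : ℕ} → List (Subset n) → Set
MeetsAllHypertrees d {n} C =
  (T : List (Subset n)) → IsHypertree d T → Any (_∈ T) C

IsHypercut : (d : ℕ) {n : ℕ} → List (Subset n) → Set
IsHypercut d {n} C =
  IsFaceSet d C × MeetsAllHypertrees d C ×
  ((C' : List (Subset n)) → IsFaceSet d C' → C' ⊆ₗ C →
     MeetsAllHypertrees d C' → C ⊆ₗ C')

{-# OPTIONS --safe #-}
-- Call a set of path vertices sparse if it contains no two consecutive ones, and add an
-- apex v to the path.  The hypercut is the coboundary of the family of sparse d-sets
-- avoiding v.  As d is even, it contains every sparse (d+1)-set avoiding v, since all of
-- its d + 1 facets are sparse; this gives the density.  A coboundary meets every hypertree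
-- by counting incidences.  For minimality, work modulo the columns of the faces outside the
-- cut.  As ∂∂ = 0, each ∂σ is a sum of columns ∂(v ∪ e), and ∂(v ∪ e) vanishes unless e is
-- sparse.  Sliding an element of a sparse set p to an adjacent vertex, with sparse result q,
-- the face p ∪ q has exactly the two sparse facets p and q; it thus lies outside the cut and
-- gives ∂(v ∪ p) = ∂(v ∪ q).  All sparse d-sets are connected by slides, so the quotient has
-- dimension one and is killed by any single face of the cut.  Hence the complement of a
-- smaller family contains a hypertree.
module Submission where

open import Defs
open import Data.Nat using (ℕ; zero; suc; _+_; _*_; _∸_; _≤_; _<_; z≤n; s≤s)
open import Data.Nat.Divisibility using (_∣_; divides; ∣-refl; _∣0; ∣m∣n⇒∣m+n)
open import Data.Nat.Combinatorics using (_C_; nCk+nC[k+1]≡[n+1]C[k+1]; nCn≡1; nC1≡n)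
open import Data.Nat.Properties
open import Data.Bool using (Bool; true; false; not; _∧_; _xor_)
open import Data.Bool.Properties
  using (xor-assoc; xor-comm; xor-identityʳ; xor-same;
         ∧-identityʳ; ∧-zeroʳ; ∧-distribˡ-xor; not-involutive; ¬-not)
  renaming (_≟_ to _≟ᵇ_)
open import Data.Fin.Subset using (Subset; inside; outside; ∣_∣; ⊥)
open import Data.Fin.Subset.Properties using (_⊆?_; p⊆q⇒∣p∣≤∣q∣)
open import Data.Vec using ([]; _∷_)
open import Data.Vec.Properties using (≡-dec; ∷-injectiveʳ)
open import Data.List using (List; []; _∷_; [_]; _++_; map; length; filter)
open import Data.List.Properties using (length-map; length-++; map-∘; filter-all)
open import Data.List.Membership.Propositional using (_∈_; _∉_; lose; find)
open import Data.List.Membership.Propositional.Properties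
  using (∈-map⁺; ∈-map⁻; ∈-++⁺ˡ; ∈-++⁺ʳ; ∈-filter⁺; ∈-filter⁻; ∈-∃++)
open import Data.List.Relation.Unary.All as All using (All; []; _∷_)
import Data.List.Relation.Unary.All.Properties as All
open import Data.List.Relation.Unary.Any using (Any; any?; here; there)
open import Data.List.Relation.Unary.AllPairs using ([]; _∷_)
open import Data.List.Relation.Unary.Unique.Propositional using (Unique)
import Data.List.Relation.Unary.Unique.Propositional.Properties as Unique
open import Data.List.Relation.Binary.Permutation.Propositional
  using (_↭_; refl; prep; swap; trans; ↭-sym; ↭⇒↭ₛ)
open import Data.List.Relation.Binary.Permutation.Propositional.Properties
  using (shift; ∈-resp-↭)
import Data.List.Relation.Binary.Permutation.Setoid.Properties as Permₛ
open import Data.List.Relation.Binary.Sublist.Propositional as Sub using () renaming (_⊆_ to _⊑_)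
import Data.List.Relation.Binary.Sublist.Propositional.Properties as Sub
open import Data.Product using (Σ; ∃; _×_; _,_; proj₁; proj₂)
open import Data.Sum using (inj₁; inj₂)
open import Function using (_∘_; const)
open import Relation.Binary.Construct.Closure.ReflexiveTransitive using (Star; ε; _◅_; _◅◅_; gmap)
open import Relation.Binary.PropositionalEquality as ≡
  using (_≡_; _≢_; refl; sym; cong; cong₂; subst; setoid; module ≡-Reasoning)
open import Relation.Nullary using (¬_; Dec; yes; no; does; contradiction)
open import Relation.Nullary.Decidable using (decidable-stable; dec-false)

private
  variable
    n m r d : ℕ

-- F₂-arithmetic

xor-cancelˡ : ∀ x y → x xor (x xor y) ≡ y
xor-cancelˡ false _ = refl
xor-cancelˡ true  y = not-involutive y

xor-false⇒≡ : ∀ x y → x xor y ≡ false → x ≡ y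
xor-false⇒≡ false false _ = refl
xor-false⇒≡ true  true  _ = refl

not-xor-not : ∀ x y → not x xor not y ≡ x xor y
not-xor-not false y = not-involutive y
not-xor-not true  _ = refl

xor-interchange : ∀ w x y z → (w xor x) xor (y xor z) ≡ (w xor y) xor (x xor z)
xor-interchange false false _     _ = refl
xor-interchange false true  false _ = refl
xor-interchange false true  true  _ = refl
xor-interchange true  false false _ = refl
xor-interchange true  false true  z = not-involutive z
xor-interchange true  true  false z = sym (not-involutive z)
xor-interchange true  true  true  z = refl

split-by : ∀ x y → (x ∧ y) xor (not x ∧ y) ≡ y
split-by false _ = refl
split-by true  y = xor-identityʳ y

odd : ℕ → Bool
odd zero    = false
odd (suc k) = not (odd k)

2∣⇒even : ∀ {k} → 2 ∣ k → odd k ≡ false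
2∣⇒even (divides q refl) = go q
  where
  go : ∀ q → odd (q * 2) ≡ false
  go zero    = refl
  go (suc q) = ≡.trans (not-involutive _) (go q)

even⇒2∣ : ∀ k → odd k ≡ false → 2 ∣ k
even⇒2∣ zero          _ = 2 ∣0
even⇒2∣ (suc (suc k)) e = ∣m∣n⇒∣m+n ∣-refl (even⇒2∣ k (≡.trans (sym (not-involutive _)) e))

-- Boundaries

∂ : Subset n → Subset n → Bool
∂ ρ τ = does (τ ⊆? ρ)

-- The coboundary of the cochain `g`, evaluated at `p`. Deleting the head element gives
-- `outside ∷ p`; the other facets keep the head.
facetSum : (Subset n → Bool) → Subset n → Bool
facetSum g []            = false
facetSum g (inside  ∷ p) = g (outside ∷ p) xor facetSum (g ∘ (inside ∷_)) p
facetSum g (outside ∷ p) = facetSum (g ∘ (outside ∷_)) p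

facetSum-cong : {g h : Subset n → Bool} (p : Subset n) →
  (∀ e → suc ∣ e ∣ ≡ ∣ p ∣ → g e ≡ h e) → facetSum g p ≡ facetSum h p
facetSum-cong []            g≗h = refl
facetSum-cong (inside  ∷ p) g≗h =
  cong₂ _xor_ (g≗h (outside ∷ p) refl) (facetSum-cong p λ e q → g≗h (inside ∷ e) (cong suc q))
facetSum-cong (outside ∷ p) g≗h = facetSum-cong p λ e q → g≗h (outside ∷ e) q

facetSum-false : (p : Subset n) → facetSum (const false) p ≡ false
facetSum-false []            = refl
facetSum-false (inside  ∷ p) = facetSum-false p
facetSum-false (outside ∷ p) = facetSum-false p

facetSum-xor : (g h : Subset n → Bool) (p : Subset n) →
  facetSum (λ e → g e xor h e) p ≡ facetSum g p xor facetSum h p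
facetSum-xor g h []            = refl
facetSum-xor g h (inside  ∷ p) =
  ≡.trans (cong ((g (outside ∷ p) xor h (outside ∷ p)) xor_) (facetSum-xor (g ∘ (inside ∷_)) (h ∘ (inside ∷_)) p))
          (xor-interchange (g (outside ∷ p)) (h (outside ∷ p)) _ _)
facetSum-xor g h (outside ∷ p) = facetSum-xor (g ∘ (outside ∷_)) (h ∘ (outside ∷_)) p

facetSum-∧ : (g : Subset n → Bool) (b : Bool) (p : Subset n) →
  facetSum (λ e → g e ∧ b) p ≡ facetSum g p ∧ b
facetSum-∧ g false p =
  ≡.trans (facetSum-cong p λ e _ → ∧-zeroʳ (g e)) (≡.trans (facetSum-false p) (sym (∧-zeroʳ _)))
facetSum-∧ g true  p =
  ≡.trans (facetSum-cong p λ e _ → ∧-identityʳ (g e)) (sym (∧-identityʳ _))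

-- A τ ⊆ ω lies in one facet of ω for each element of ω ∖ τ.
facetSum-∂ : (ω τ : Subset n) →
  facetSum (λ e → ∂ e τ) ω ≡ ∂ ω τ ∧ (odd ∣ ω ∣ xor odd ∣ τ ∣)
facetSum-∂ []            []            = refl
facetSum-∂ (inside  ∷ ω) (inside  ∷ τ) =
  ≡.trans (facetSum-∂ ω τ) (cong (∂ ω τ ∧_) (sym (not-xor-not (odd ∣ ω ∣) (odd ∣ τ ∣))))
facetSum-∂ (inside  ∷ ω) (outside ∷ τ) rewrite facetSum-∂ ω τ with ∂ ω τ | odd ∣ ω ∣
... | false | _     = refl
... | true  | false = refl
... | true  | true  = not-involutive _
facetSum-∂ (outside ∷ ω) (inside  ∷ τ) = facetSum-false ω
facetSum-∂ (outside ∷ ω) (outside ∷ τ) = facetSum-∂ ω τ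

-- This is ∂∂ = 0 read at the row `τ`: the two sizes differ by two, so an even number of facets of
-- `ω` contain `τ`.
facetSum-∂∂ : (ω τ : Subset n) → ∣ ω ∣ ≡ suc (suc ∣ τ ∣) → facetSum (λ e → ∂ e τ) ω ≡ false
facetSum-∂∂ ω τ eq = begin
  facetSum (λ e → ∂ e τ) ω               ≡⟨ facetSum-∂ ω τ ⟩
  ∂ ω τ ∧ (odd ∣ ω ∣ xor odd ∣ τ ∣)       ≡⟨ cong (λ k → ∂ ω τ ∧ (odd k xor odd ∣ τ ∣)) eq ⟩
  ∂ ω τ ∧ (not (not (odd ∣ τ ∣)) xor odd ∣ τ ∣)
    ≡⟨ cong (λ b → ∂ ω τ ∧ (b xor odd ∣ τ ∣)) (not-involutive (odd ∣ τ ∣)) ⟩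
  ∂ ω τ ∧ (odd ∣ τ ∣ xor odd ∣ τ ∣)       ≡⟨ cong (∂ ω τ ∧_) (xor-same (odd ∣ τ ∣)) ⟩
  ∂ ω τ ∧ false                          ≡⟨ ∧-zeroʳ _ ⟩
  false                                  ∎
  where open ≡-Reasoning

-- Sums over all subsets of a fixed size

levelSum : (r : ℕ) → (Subset n → Bool) → Bool
levelSum {zero}  zero    f = f []
levelSum {zero}  (suc r) f = false
levelSum {suc n} zero    f = levelSum zero (f ∘ (outside ∷_))
levelSum {suc n} (suc r) f = levelSum r (f ∘ (inside ∷_)) xor levelSum (suc r) (f ∘ (outside ∷_))

levelSum-cong : ∀ r {f g : Subset n → Bool} →
  (∀ τ → ∣ τ ∣ ≡ r → f τ ≡ g τ) → levelSum r f ≡ levelSum r g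
levelSum-cong {zero}  zero    f≗g = f≗g [] refl
levelSum-cong {zero}  (suc r) f≗g = refl
levelSum-cong {suc n} zero    f≗g = levelSum-cong zero λ τ → f≗g (outside ∷ τ)
levelSum-cong {suc n} (suc r) f≗g =
  cong₂ _xor_ (levelSum-cong r λ τ q → f≗g (inside ∷ τ) (cong suc q))
              (levelSum-cong (suc r) λ τ → f≗g (outside ∷ τ))

levelSum-false : ∀ n r → levelSum {n} r (const false) ≡ false
levelSum-false zero    zero    = refl
levelSum-false zero    (suc r) = refl
levelSum-false (suc n) zero    = levelSum-false n zero
levelSum-false (suc n) (suc r) = cong₂ _xor_ (levelSum-false n r) (levelSum-false n (suc r))

levelSum-xor : ∀ r (f g : Subset n → Bool) →
  levelSum r (λ τ → f τ xor g τ) ≡ levelSum r f xor levelSum r g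
levelSum-xor {zero}  zero    f g = refl
levelSum-xor {zero}  (suc r) f g = refl
levelSum-xor {suc n} zero    f g = levelSum-xor zero (f ∘ (outside ∷_)) (g ∘ (outside ∷_))
levelSum-xor {suc n} (suc r) f g =
  ≡.trans (cong₂ _xor_ (levelSum-xor r (f ∘ (inside ∷_)) (g ∘ (inside ∷_)))
                       (levelSum-xor (suc r) (f ∘ (outside ∷_)) (g ∘ (outside ∷_))))
          (xor-interchange (levelSum r (f ∘ (inside ∷_))) (levelSum r (g ∘ (inside ∷_))) _ _)

levelSum-vanish : ∀ r {f : Subset n → Bool} →
  (∀ τ → ∣ τ ∣ ≡ r → f τ ≡ false) → levelSum r f ≡ false
levelSum-vanish {n} r f≗0 = ≡.trans (levelSum-cong r f≗0) (levelSum-false n r)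

levelSum-above : ∀ (f : Subset n → Bool) ρ r → ∣ ρ ∣ < r → levelSum r (λ τ → f τ ∧ ∂ ρ τ) ≡ false
levelSum-above f ρ r ρ<r = levelSum-vanish r λ τ τ≡r →
  ≡.trans (cong (f τ ∧_) (dec-false (τ ⊆? ρ) λ τ⊆ρ →
            <⇒≱ ρ<r (subst (_≤ ∣ ρ ∣) τ≡r (p⊆q⇒∣p∣≤∣q∣ τ⊆ρ))))
          (∧-zeroʳ _)

levelSum-top : ∀ (f : Subset n → Bool) ρ r → ∣ ρ ∣ ≡ r → levelSum r (λ τ → f τ ∧ ∂ ρ τ) ≡ f ρ
levelSum-top f []            zero    _  = ∧-identityʳ _
levelSum-top f (inside  ∷ ρ) (suc r) eq =
  ≡.trans (cong₂ _xor_ (levelSum-top (f ∘ (inside ∷_)) ρ r (suc-injective eq))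
                       (levelSum-above (f ∘ (outside ∷_)) ρ (suc r) (≤-reflexive eq)))
          (xor-identityʳ _)
levelSum-top f (outside ∷ ρ) zero    eq = levelSum-top (f ∘ (outside ∷_)) ρ zero eq
levelSum-top f (outside ∷ ρ) (suc r) eq =
  cong₂ _xor_ (levelSum-vanish r {λ τ → f (inside ∷ τ) ∧ false} λ τ _ → ∧-zeroʳ _) (levelSum-top (f ∘ (outside ∷_)) ρ (suc r) eq)

-- The `r`-subsets of an (r + 1)-set are its facets. If the head lies in `ρ`, those that contain it
-- are handled recursively, and the only one that avoids it is the rest of `ρ`.
levelSum-facets : ∀ (f : Subset n → Bool) ρ r → ∣ ρ ∣ ≡ suc r →
  levelSum r (λ τ → f τ ∧ ∂ ρ τ) ≡ facetSum f ρ
levelSum-facets f (inside  ∷ ρ) zero    eq =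
  ≡.trans (levelSum-top (f ∘ (outside ∷_)) ρ zero (suc-injective eq))
    (≡.trans (sym (xor-identityʳ _))
      (cong (f (outside ∷ ρ) xor_) (sym
        -- Here `ρ` is empty and has no facets.
        (≡.trans (facetSum-cong ρ λ e q → contradiction (≡.trans q (suc-injective eq)) λ ())
                 (facetSum-false ρ)))))
levelSum-facets f (inside  ∷ ρ) (suc r) eq =
  ≡.trans (cong₂ _xor_ (levelSum-facets (f ∘ (inside ∷_)) ρ r (suc-injective eq))
                       (levelSum-top (f ∘ (outside ∷_)) ρ (suc r) (suc-injective eq)))
          (xor-comm (facetSum (f ∘ (inside ∷_)) ρ) _)
levelSum-facets f (outside ∷ ρ) zero    eq = levelSum-facets (f ∘ (outside ∷_)) ρ zero eq
levelSum-facets f (outside ∷ ρ) (suc r) eq =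
  cong₂ _xor_ (levelSum-vanish r {λ τ → f (inside ∷ τ) ∧ false} λ τ _ → ∧-zeroʳ _) (levelSum-facets (f ∘ (outside ∷_)) ρ (suc r) eq)

-- Sums of columns over lists of faces

xorSum : {A : Set} → (A → Bool) → List A → Bool
xorSum f []       = false
xorSum f (x ∷ xs) = f x xor xorSum f xs

xorSum-↭ : {A : Set} (f : A → Bool) {xs ys : List A} → xs ↭ ys → xorSum f xs ≡ xorSum f ys
xorSum-↭ f refl         = refl
xorSum-↭ f (prep x p)   = cong (f x xor_) (xorSum-↭ f p)
xorSum-↭ f (swap x y p) =
  ≡.trans (cong (λ b → f x xor (f y xor b)) (xorSum-↭ f p))
    (≡.trans (sym (xor-assoc (f x) (f y) _))
      (≡.trans (cong (_xor _) (xor-comm (f x) (f y))) (xor-assoc (f y) (f x) _)))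
xorSum-↭ f (trans p q)  = ≡.trans (xorSum-↭ f p) (xorSum-↭ f q)

xorSum-vanish : {A : Set} (f : A → Bool) (xs : List A) →
  (∀ {x} → x ∈ xs → f x ≡ false) → xorSum f xs ≡ false
xorSum-vanish f []       f≗0 = refl
xorSum-vanish f (x ∷ xs) f≗0 = cong₂ _xor_ (f≗0 (here refl)) (xorSum-vanish f xs (f≗0 ∘ there))

extract : {A : Set} {x : A} {xs : List A} → Unique xs → x ∈ xs →
  ∃ λ ys → xs ↭ x ∷ ys × x ∉ ys × Unique ys
extract {A} {x} u x∈xs with ys , zs , refl ← ∈-∃++ x∈xs
  with q ∷ u′ ← Permₛ.Unique-resp-↭ (setoid A) (↭⇒↭ₛ (shift x ys zs)) u =
  ys ++ zs , shift x ys zs , (λ i → All.lookup q i refl) , u′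

columnSum : List (Subset n) → Subset n → Bool
columnSum S τ = xorSum (λ ρ → ∂ ρ τ) S

odd-length-filter : (S : List (Subset n)) (τ : Subset n) →
  odd (length (filter (τ ⊆?_) S)) ≡ columnSum S τ
odd-length-filter []      τ = refl
odd-length-filter (ρ ∷ S) τ with does (τ ⊆? ρ)
... | false = odd-length-filter S τ
... | true  = cong not (odd-length-filter S τ)

zeroSum⇒columnSum : (S : List (Subset n)) → ZeroSum d S → ∀ τ → ∣ τ ∣ ≡ d → columnSum S τ ≡ false
zeroSum⇒columnSum S z τ eq = ≡.trans (sym (odd-length-filter S τ)) (2∣⇒even (z τ eq))

columnSum⇒zeroSum : (S : List (Subset n)) → (∀ τ → ∣ τ ∣ ≡ d → columnSum S τ ≡ false) → ZeroSum d S
columnSum⇒zeroSum S z τ eq = even⇒2∣ _ (≡.trans (odd-length-filter S τ) (z τ eq))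

-- Boundary and coboundary are adjoint: pairing `A` with the boundary of `S` equals pairing the
-- coboundary of `A` with `S`.
levelSum-columnSum : (A : Subset n → Bool) (S : List (Subset n)) → All (IsFace d) S →
  levelSum d (λ τ → A τ ∧ columnSum S τ) ≡ xorSum (facetSum A) S
levelSum-columnSum {d = d} A []      []       = levelSum-vanish d λ τ _ → ∧-zeroʳ (A τ)
levelSum-columnSum {d = d} A (ρ ∷ S) (f ∷ fs) = begin
  levelSum d (λ τ → A τ ∧ (∂ ρ τ xor columnSum S τ))
    ≡⟨ levelSum-cong d (λ τ _ → ∧-distribˡ-xor (A τ) _ _) ⟩
  levelSum d (λ τ → (A τ ∧ ∂ ρ τ) xor (A τ ∧ columnSum S τ))
    ≡⟨ levelSum-xor d (λ τ → A τ ∧ ∂ ρ τ) _ ⟩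
  levelSum d (λ τ → A τ ∧ ∂ ρ τ) xor levelSum d (λ τ → A τ ∧ columnSum S τ)
    ≡⟨ cong₂ _xor_ (levelSum-facets A ρ d f) (levelSum-columnSum A S fs) ⟩
  facetSum A ρ xor xorSum (facetSum A) S ∎
  where open ≡-Reasoning

-- By adjointness this is the pairing of `A` with a zero boundary: a coboundary meets every cycle in
-- an even number of faces.
zeroSum⇒even-coboundary : (A : Subset n → Bool) {S : List (Subset n)} → All (IsFace d) S →
  ZeroSum d S → xorSum (facetSum A) S ≡ false
zeroSum⇒even-coboundary {d = d} A {S} fs z = ≡.trans (sym (levelSum-columnSum A S fs))
  (levelSum-vanish d λ τ eq → ≡.trans (cong (A τ ∧_) (zeroSum⇒columnSum S z τ eq)) (∧-zeroʳ _))

-- Column spans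

-- Vectors are functions on all subsets, but only the rows of size `d` count. Each constructor takes
-- a pointwise equation on these rows, so that the span respects equality there.
data Span (d : ℕ) (K : Subset n → Set) : (Subset n → Bool) → Set where
  zero : ∀ {u} → (∀ τ → ∣ τ ∣ ≡ d → u τ ≡ false) → Span d K u
  add  : ∀ {u w ρ} → K ρ → Span d K u → (∀ τ → ∣ τ ∣ ≡ d → w τ ≡ ∂ ρ τ xor u τ) → Span d K w

module _ {K : Subset n → Set} where

  span-resp : {u w : Subset n → Bool} → (∀ τ → ∣ τ ∣ ≡ d → w τ ≡ u τ) → Span d K u → Span d K w
  span-resp w≗u (zero u≗0)    = zero λ τ q → ≡.trans (w≗u τ q) (u≗0 τ q)
  span-resp w≗u (add k s u≗) = add k s λ τ q → ≡.trans (w≗u τ q) (u≗ τ q)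

  span-generator : ∀ {ρ} → K ρ → Span d K (∂ ρ)
  span-generator k = add k (zero {u = const false} λ _ _ → refl) λ τ _ → sym (xor-identityʳ _)

  span-xor : {u w : Subset n → Bool} → Span d K u → Span d K w → Span d K (λ τ → u τ xor w τ)
  span-xor {w = w} (zero u≗0)    t = span-resp (λ τ q → cong (_xor w τ) (u≗0 τ q)) t
  span-xor {w = w} (add {u = u} {ρ = ρ} k s u≗) t =
    add k (span-xor s t) λ τ q → ≡.trans (cong (_xor w τ) (u≗ τ q)) (xor-assoc (∂ ρ τ) (u τ) (w τ))

  span-∧ : {u : Subset n → Bool} (b : Bool) → Span d K u → Span d K (λ τ → b ∧ u τ)
  span-∧ false s = zero λ _ _ → refl
  span-∧ true  s = s

  span-facetSum : (p : Subset m) (u : Subset m → Subset n → Bool) →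
    (∀ e → suc ∣ e ∣ ≡ ∣ p ∣ → Span d K (u e)) → Span d K (λ τ → facetSum (λ e → u e τ) p)
  span-facetSum []            u s = zero λ _ _ → refl
  span-facetSum (inside  ∷ p) u s =
    span-xor (s (outside ∷ p) refl) (span-facetSum p (u ∘ (inside ∷_)) λ e q → s (inside ∷ e) (cong suc q))
  span-facetSum (outside ∷ p) u s = span-facetSum p (u ∘ (outside ∷_)) λ e → s (outside ∷ e)

span-trans : {K L : Subset n → Set} {u : Subset n → Bool} →
  (∀ {ρ} → K ρ → Span d L (∂ ρ)) → Span d K u → Span d L u
span-trans K⊆L (zero u≗0)    = zero u≗0
span-trans K⊆L (add k s u≗) = span-resp u≗ (span-xor (K⊆L k) (span-trans K⊆L s))

columnSum-span : {T : List (Subset n)} (S : List (Subset n)) → S ⊆ₗ T → Span d (_∈ T) (columnSum S)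
columnSum-span []      S⊆T = zero λ _ _ → refl
columnSum-span (ρ ∷ S) S⊆T = add (S⊆T (here refl)) (columnSum-span S (S⊆T ∘ there)) λ _ _ → refl

_≟ˢ_ : (p q : Subset n) → Dec (p ≡ q)
_≟ˢ_ = ≡-dec _≟ᵇ_

_∈?_ : (p : Subset n) (L : List (Subset n)) → Dec (p ∈ L)
p ∈? L = any? (p ≟ˢ_) L

-- Coefficients lie in F₂, so a generator that occurs again cancels: it is removed from the list,
-- which keeps the list free of repetitions.
span⇒columnSum : {T : List (Subset n)} {u : Subset n → Bool} → Span d (_∈ T) u →
  ∃ λ S → Unique S × S ⊆ₗ T × (∀ τ → ∣ τ ∣ ≡ d → u τ ≡ columnSum S τ)
span⇒columnSum (zero u≗0) = [] , [] , (λ ()) , u≗0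
span⇒columnSum (add {ρ = ρ} k s u≗) with S , uS , S⊆T , eq ← span⇒columnSum s | ρ ∈? S
... | no ρ∉S = ρ ∷ S , All.¬Any⇒All¬ S ρ∉S ∷ uS , (λ { (here refl) → k ; (there i) → S⊆T i }) ,
               λ τ q → ≡.trans (u≗ τ q) (cong (∂ ρ τ xor_) (eq τ q))
... | yes ρ∈S with S′ , perm , _ , uS′ ← extract uS ρ∈S =
  S′ , uS′ , (λ i → S⊆T (∈-resp-↭ (↭-sym perm) (there i))) , λ τ q →
    ≡.trans (u≗ τ q) (≡.trans
      (cong (∂ ρ τ xor_) (≡.trans (eq τ q) (xorSum-↭ (λ σ → ∂ σ τ) perm)))
      (xor-cancelˡ (∂ ρ τ) _))

-- Linear independence and bases

∉-⊆-tail : {A : Set} {x : A} {S T : List A} → x ∉ S → (∀ {y} → y ∈ S → y ∈ x ∷ T) → ∀ {y} → y ∈ S → y ∈ T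
∉-⊆-tail x∉S S⊆ y∈S with S⊆ y∈S
... | here refl = contradiction y∈S x∉S
... | there i   = i

-- Writing `∂ σ` as the column sum of some `S` within `T` makes `σ ∷ S` a nonempty zero sum.
span⇒¬acyclic : {T : List (Subset n)} {σ : Subset n} → σ ∉ T → Span d (_∈ T) (∂ σ) → ¬ Acyclic d (σ ∷ T)
span⇒¬acyclic {σ = σ} σ∉T s ac with S , uS , S⊆T , eq ← span⇒columnSum s =
  ac (σ ∷ S) (All.¬Any⇒All¬ S (σ∉T ∘ S⊆T) ∷ uS)
     (λ { (here refl) → here refl ; (there i) → there (S⊆T i) }) (λ ())
     (columnSum⇒zeroSum (σ ∷ S) λ τ q →
       ≡.trans (cong (_xor columnSum S τ) (eq τ q)) (xor-same (columnSum S τ)))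

-- A zero sum without `ρ` lies in `T`; one through `ρ` expresses `∂ ρ` by the remaining columns.
acyclic-∷ : {T : List (Subset n)} {ρ : Subset n} → Acyclic d T → ¬ Span d (_∈ T) (∂ ρ) → Acyclic d (ρ ∷ T)
acyclic-∷ {ρ = ρ} ac ¬s S uS S⊆ S≢[] z with ρ ∈? S
... | no ρ∉S = ac S uS (∉-⊆-tail ρ∉S S⊆) S≢[] z
... | yes ρ∈S with S′ , perm , ρ∉S′ , _ ← extract uS ρ∈S = ¬s
  (span-resp
    (λ τ q → xor-false⇒≡ (∂ ρ τ) _
      (≡.trans (sym (xorSum-↭ (λ σ → ∂ σ τ) perm)) (zeroSum⇒columnSum S z τ q)))
    (columnSum-span S′ (∉-⊆-tail ρ∉S′ λ i → S⊆ (∈-resp-↭ (↭-sym perm) (there i)))))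

-- Doubly negated because membership in a span is not decided here.
basis : (L : List (Subset n)) → All (IsFace d) L → ¬ ¬ (Σ (List (Subset n)) λ T →
  IsFaceSet d T × Acyclic d T × T ⊆ₗ L × (∀ {ρ} → ρ ∈ L → Span d (_∈ T) (∂ ρ)))
basis []      [] k = k ([] , ([] , []) , (λ { [] _ _ S≢[] _ → S≢[] refl ; (_ ∷ _) _ S⊆ _ _ → contradiction (S⊆ (here refl)) λ () })
                        , (λ ()) , λ ())
basis {d = d} (ρ ∷ L) (f ∷ fs) k = basis L fs λ { (T , (uT , fT) , ac , T⊆L , sp) →
  let ¬s : ¬ Span d (_∈ T) (∂ ρ)
      ¬s s = k (T , (uT , fT) , ac , there ∘ T⊆L , λ { (here refl) → s ; (there i) → sp i })
  in k (ρ ∷ T , (All.¬Any⇒All¬ T (¬s ∘ span-generator) ∷ uT , f ∷ fT) , acyclic-∷ ac ¬s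
       , (λ { (here refl) → here refl ; (there i) → there (T⊆L i) })
       , λ { (here refl) → span-generator (here refl)
           ; (there i)   → span-trans (span-generator ∘ there) (sp i) }) }

-- Enumeration of the r-subsets

subsets : (n r : ℕ) → List (Subset n)
subsets zero    zero    = [ [] ]
subsets zero    (suc r) = []
subsets (suc n) zero    = map (outside ∷_) (subsets n zero)
subsets (suc n) (suc r) = map (inside ∷_) (subsets n r) ++ map (outside ∷_) (subsets n (suc r))

∈-subsets : (p : Subset n) → ∣ p ∣ ≡ r → p ∈ subsets n r
∈-subsets []            refl = here refl
∈-subsets (inside  ∷ p) refl = ∈-++⁺ˡ (∈-map⁺ (inside ∷_) (∈-subsets p refl))
∈-subsets {r = zero}            (outside ∷ p) eq = ∈-map⁺ (outside ∷_) (∈-subsets p eq)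
∈-subsets {n = suc n} {r = suc r} (outside ∷ p) eq =
  ∈-++⁺ʳ (map (inside ∷_) (subsets n r)) (∈-map⁺ (outside ∷_) (∈-subsets p eq))

subsets-size : (n r : ℕ) → All (λ p → ∣ p ∣ ≡ r) (subsets n r)
subsets-size zero    zero    = refl ∷ []
subsets-size zero    (suc r) = []
subsets-size (suc n) zero    = All.map⁺ (subsets-size n zero)
subsets-size (suc n) (suc r) =
  All.++⁺ (All.map⁺ (All.map (cong suc) (subsets-size n r))) (All.map⁺ (subsets-size n (suc r)))

subsets-unique : (n r : ℕ) → Unique (subsets n r)
subsets-unique zero    zero    = [] ∷ []
subsets-unique zero    (suc r) = []
subsets-unique (suc n) zero    = Unique.map⁺ ∷-injectiveʳ (subsets-unique n zero)
subsets-unique (suc n) (suc r) =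
  Unique.++⁺ (Unique.map⁺ ∷-injectiveʳ (subsets-unique n r))
             (Unique.map⁺ ∷-injectiveʳ (subsets-unique n (suc r)))
             λ { (i , j) → disjoint (∈-map⁻ _ i) (∈-map⁻ _ j) }
  where
  disjoint : ∀ {p : Subset (suc n)} {xs ys} → (∃ λ q → q ∈ xs × p ≡ inside ∷ q) →
    ¬ (∃ λ q → q ∈ ys × p ≡ outside ∷ q)
  disjoint (_ , _ , refl) (_ , _ , ())

-- Sparse sets and token sliding

sparse : Subset n → Bool
sparse []                     = true
sparse (outside ∷ p)          = sparse p
sparse (inside ∷ [])          = true
sparse (inside ∷ outside ∷ p) = sparse p
sparse (inside ∷ inside ∷ p)  = false

-- Every facet of a sparse set is sparse, so each element contributes one.
facetSum-sparse : (p : Subset n) → sparse p ≡ true → facetSum sparse p ≡ odd ∣ p ∣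
facetSum-sparse []                     s = refl
facetSum-sparse (outside ∷ p)          s = facetSum-sparse p s
facetSum-sparse (inside ∷ [])          s = refl
facetSum-sparse (inside ∷ outside ∷ p) s = cong₂ _xor_ s (facetSum-sparse p s)

-- One token moves one vertex towards the head. The premises of `move` make both ends sparse, and
-- the prefixes added by `skip` and `skip₂` keep them so.
data Slide : Subset n → Subset n → Set where
  move   : (p : Subset n) → sparse p ≡ true → sparse (inside ∷ p) ≡ true →
           Slide (outside ∷ inside ∷ p) (inside ∷ outside ∷ p)
  skip   : {p q : Subset n} → Slide p q → Slide (outside ∷ p) (outside ∷ q)
  skip₂  : {p q : Subset n} → Slide p q → Slide (inside ∷ outside ∷ p) (inside ∷ outside ∷ q)

slide-size : {p q : Subset n} → Slide p q → ∣ p ∣ ≡ ∣ q ∣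
slide-size (move p _ _) = refl
slide-size (skip s)     = slide-size s
slide-size (skip₂ s)    = cong suc (slide-size s)

slides-size : {p q : Subset n} → Star Slide p q → ∣ p ∣ ≡ ∣ q ∣
slides-size ε        = refl
slides-size (s ◅ ss) = ≡.trans (slide-size s) (slides-size ss)

-- Quantifying over g says that p and q are the only sparse facets of σ, their union.
slide-union : {p q : Subset n} → Slide p q →
  ∃ λ σ → ∣ σ ∣ ≡ suc ∣ p ∣ × sparse σ ≡ false ×
    (∀ g → facetSum (λ e → sparse e ∧ g e) σ ≡ g p xor g q)
slide-union (move p s s′) = inside ∷ inside ∷ p , refl , refl , λ g →
  ≡.trans (cong₂ _xor_ (cong (_∧ g (outside ∷ inside ∷ p)) s′)
             (cong₂ _xor_ (cong (_∧ g (inside ∷ outside ∷ p)) s) (facetSum-false p)))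
    (cong (g (outside ∷ inside ∷ p) xor_) (xor-identityʳ (g (inside ∷ outside ∷ p))))
slide-union (skip s) with σ , size , ns , sum ← slide-union s =
  outside ∷ σ , size , ns , λ g → sum (g ∘ (outside ∷_))
slide-union (skip₂ s) with σ , size , ns , sum ← slide-union s =
  inside ∷ outside ∷ σ , cong suc size , ns , λ g →
    cong₂ _xor_ (cong (_∧ g (outside ∷ outside ∷ σ)) ns) (sum (λ e → g (inside ∷ outside ∷ e)))

-- The leftmost sparse r-subset, truncated if it does not fit.
packed : (n r : ℕ) → Subset n
packed n             zero    = ⊥
packed zero          (suc r) = []
packed (suc zero)    (suc r) = inside ∷ []
packed (suc (suc n)) (suc r) = inside ∷ outside ∷ packed n r

sparse-⊥ : ∀ n → sparse (⊥ {n}) ≡ true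
sparse-⊥ zero    = refl
sparse-⊥ (suc n) = sparse-⊥ n

sparse-packed : (n r : ℕ) → sparse (packed n r) ≡ true
sparse-packed n             zero    = sparse-⊥ n
sparse-packed zero          (suc r) = refl
sparse-packed (suc zero)    (suc r) = refl
sparse-packed (suc (suc n)) (suc r) = sparse-packed n r

-- The tokens advance one vertex each, starting with the one nearest the head, so every token finds
-- room. The hypothesis excludes a truncated `packed n r`.
pack-outside : (n r : ℕ) → ∣ packed n r ∣ ≡ r → Star Slide (outside ∷ packed n r) (packed (suc n) r)
pack-outside n             zero          _  = ε
pack-outside (suc zero)    (suc zero)    _  = move [] refl refl ◅ ε
pack-outside (suc (suc n)) (suc r)       eq =
  move (outside ∷ packed n r) (sparse-packed n r) (sparse-packed n r) ◅
  gmap (λ p → inside ∷ outside ∷ p) skip₂ (pack-outside n r (suc-injective eq))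

-- All sparse sets of one size slide to a common target. If the head is free, the tail is packed
-- first and then shifted as a whole.
pack : (p : Subset n) → sparse p ≡ true → Star Slide p (packed n ∣ p ∣)
pack []                     s = ε
pack (inside ∷ [])          s = ε
pack (inside ∷ outside ∷ p) s = gmap (λ p → inside ∷ outside ∷ p) skip₂ (pack p s)
pack (outside ∷ p)          s = let ss = pack p s in
  -- Slides preserve size, so the packed tail is not truncated.
  gmap (outside ∷_) skip ss ◅◅ pack-outside _ ∣ p ∣ (sym (slides-size ss))

-- The hypercut

-- The vertex zero is the apex of a cone; the other vertices form the path.
sparseOffApex : Subset (suc m) → Bool
sparseOffApex (inside  ∷ _) = false
sparseOffApex (outside ∷ e) = sparse e

cut : Subset (suc m) → Bool
cut = facetSum sparseOffApex

-- A face through the apex has just one facet that avoids the apex.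
cut-inside : (e : Subset m) → cut (inside ∷ e) ≡ sparse e
cut-inside e = ≡.trans (cong (sparse e xor_) (facetSum-false e)) (xor-identityʳ _)

cone : Subset m → Subset (suc m) → Bool
cone e = ∂ (inside ∷ e)

-- Apply ∂∂ = 0 to the cone over `σ`: its facets are `σ` itself and the cones over the facets of
-- `σ`.
∂-outside : (σ : Subset m) → ∣ σ ∣ ≡ suc d → ∀ τ → ∣ τ ∣ ≡ d →
  ∂ (outside ∷ σ) τ ≡ facetSum (λ e → cone e τ) σ
∂-outside σ σ≡ τ τ≡ = xor-false⇒≡ _ _
  (facetSum-∂∂ (inside ∷ σ) τ (cong suc (≡.trans σ≡ (cong suc (sym τ≡)))))

-- The quotient by the columns of faces outside the cut

module _ {K : Subset (suc m) → Set} (K⊇ : ∀ {ρ} → IsFace d ρ → cut ρ ≡ false → K ρ) where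

  span-cone : (e : Subset m) → ∣ e ∣ ≡ d → sparse e ≡ false → Span d K (cone e)
  span-cone e e≡ ns = span-generator (K⊇ (cong suc e≡) (≡.trans (cut-inside e) ns))

  -- Expand the boundary of the union `σ` into cones by `∂-outside`. The non-sparse facets,
  -- collected in `rest`, have cones in the span, which leaves the cones over `p` and `q`.
  slide-≡ : {p q : Subset m} → Slide p q → ∣ p ∣ ≡ d → Span d K (λ τ → cone p τ xor cone q τ)
  slide-≡ {p} {q} s p≡ with σ , size , _ , sum ← slide-union s =
    span-resp eq (span-xor (span-generator (K⊇ σ≡ even)) (span-facetSum σ rest rest-span))
    where
    open ≡-Reasoning
    σ≡ : ∣ σ ∣ ≡ suc d
    σ≡ = ≡.trans size (cong suc p≡)
    -- For `g` constantly true the two sparse facets cancel, so `outside ∷ σ` lies outside the cut.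
    even : facetSum sparse σ ≡ false
    even = ≡.trans (facetSum-cong σ λ e _ → sym (∧-identityʳ (sparse e))) (sum (const true))
    rest : Subset m → Subset (suc m) → Bool
    rest e τ = not (sparse e) ∧ cone e τ
    rest-span : ∀ e → suc ∣ e ∣ ≡ ∣ σ ∣ → Span d K (rest e)
    rest-span e e≡ with sparse e in ns
    ... | true  = zero λ _ _ → refl
    ... | false = span-cone e (suc-injective (≡.trans e≡ σ≡)) ns
    eq : ∀ τ → ∣ τ ∣ ≡ d →
      cone p τ xor cone q τ ≡ ∂ (outside ∷ σ) τ xor facetSum (λ e → rest e τ) σ
    eq τ τ≡ = sym (begin
      ∂ (outside ∷ σ) τ xor y
        ≡⟨ cong (_xor y) (∂-outside σ σ≡ τ τ≡) ⟩
      facetSum (λ e → cone e τ) σ xor y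
        ≡⟨ cong (_xor y) (facetSum-cong σ λ e _ → sym (split-by (sparse e) (cone e τ))) ⟩
      facetSum (λ e → (sparse e ∧ cone e τ) xor rest e τ) σ xor y
        ≡⟨ cong (_xor y) (facetSum-xor (λ e → sparse e ∧ cone e τ) (λ e → rest e τ) σ) ⟩
      (x xor y) xor y
        ≡⟨ xor-assoc x y y ⟩
      x xor (y xor y)
        ≡⟨ cong (x xor_) (xor-same y) ⟩
      x xor false
        ≡⟨ xor-identityʳ x ⟩
      x
        ≡⟨ sum (λ e → cone e τ) ⟩
      cone p τ xor cone q τ ∎)
      where
      x y : Bool
      x = facetSum (λ e → sparse e ∧ cone e τ) σ
      y = facetSum (λ e → rest e τ) σ

  slides-≡ : {p q : Subset m} → Star Slide p q → ∣ p ∣ ≡ d → Span d K (λ τ → cone p τ xor cone q τ)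
  slides-≡ {p} ε _ = zero λ τ _ → xor-same (cone p τ)
  slides-≡ {p} {q} (_◅_ {j = r} s ss) p≡ =
    span-resp
      (λ τ _ → sym (≡.trans (xor-assoc (cone p τ) (cone r τ) _)
                            (cong (cone p τ xor_) (xor-cancelˡ (cone r τ) (cone q τ)))))
      (span-xor (slide-≡ s p≡) (slides-≡ ss (≡.trans (sym (slide-size s)) p≡)))

  base : Subset (suc m) → Bool
  base = cone (packed m d)

  cone-≡ : (e : Subset m) → ∣ e ∣ ≡ d → Span d K (λ τ → cone e τ xor (sparse e ∧ base τ))
  cone-≡ e refl with sparse e in s
  ... | true  = slides-≡ (pack e s) refl
  ... | false = span-resp (λ τ _ → xor-identityʳ (cone e τ)) (span-cone e refl s)

  -- Modulo the span, `base` generates all columns, and `cut` gives their coordinates. A face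
  -- avoiding the apex is expanded into cones, and the coordinates add up to the coboundary.
  ∂-≡ : (ρ : Subset (suc m)) → IsFace d ρ → Span d K (λ τ → ∂ ρ τ xor (cut ρ ∧ base τ))
  ∂-≡ (inside  ∷ e) f =
    span-resp (λ τ _ → cong (λ b → cone e τ xor (b ∧ base τ)) (cut-inside e)) (cone-≡ e (suc-injective f))
  ∂-≡ (outside ∷ σ) f = span-resp
    (λ τ τ≡ → ≡.trans
      (cong₂ _xor_ (∂-outside σ f τ τ≡) (sym (facetSum-∧ sparse (base τ) σ)))
      (sym (facetSum-xor (λ e → cone e τ) (λ e → sparse e ∧ base τ) σ)))
    (span-facetSum σ (λ e τ → cone e τ xor (sparse e ∧ base τ)) λ e e≡ →
      cone-≡ e (suc-injective (≡.trans e≡ f)))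

  -- A face with coordinate one puts `base` into the span, which kills the whole quotient.
  span-all : {σ : Subset (suc m)} → IsFace d σ → cut σ ≡ true → K σ →
    (ρ : Subset (suc m)) → IsFace d ρ → Span d K (∂ ρ)
  span-all {σ} fσ cσ kσ ρ fρ = span-resp
    (λ τ _ → sym (≡.trans (xor-assoc (∂ ρ τ) (cut ρ ∧ base τ) _)
      (≡.trans (cong (∂ ρ τ xor_) (xor-same (cut ρ ∧ base τ))) (xor-identityʳ _))))
    (span-xor (∂-≡ ρ fρ) (span-∧ (cut ρ) span-base))
    where
    span-base : Span d K base
    span-base = span-resp
      (λ τ _ → sym (≡.trans (cong (λ b → ∂ σ τ xor (∂ σ τ xor (b ∧ base τ))) cσ)
                            (xor-cancelˡ (∂ σ τ) (base τ))))
      (span-xor (span-generator kσ) (∂-≡ σ fσ))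

-- The hypercut property

cutFaces : (d m : ℕ) → List (Subset (suc m))
cutFaces d m = filter (λ σ → cut σ ≟ᵇ true) (subsets (suc m) (suc d))

∈-cutFaces⁺ : {σ : Subset (suc m)} → IsFace d σ → cut σ ≡ true → σ ∈ cutFaces d m
∈-cutFaces⁺ {σ = σ} f c = ∈-filter⁺ (λ σ → cut σ ≟ᵇ true) (∈-subsets σ f) c

∈-cutFaces⁻ : {σ : Subset (suc m)} → σ ∈ cutFaces d m → IsFace d σ × cut σ ≡ true
∈-cutFaces⁻ {m} {d} i with j , c ← ∈-filter⁻ (λ σ → cut σ ≟ᵇ true) i =
  All.lookup (subsets-size (suc m) (suc d)) j , c

-- If a hypertree `T` missed the cut, a zero sum in `σ ∷ T` through `σ` would meet the coboundary in
-- `σ` alone, an odd number of faces. So `σ ∷ T` would be acyclic, against maximality.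
cutFaces-meets : {σ : Subset (suc m)} → σ ∈ cutFaces d m → MeetsAllHypertrees d (cutFaces d m)
cutFaces-meets {σ = σ} i T ((_ , fT) , ac , max) =
  decidable-stable (any? (_∈? T) _) λ ¬meet → max σ (proj₁ (∈-cutFaces⁻ i)) (¬meet ∘ lose i) (ac′ ¬meet)
  where
  ac′ : ¬ Any (_∈ T) (cutFaces _ _) → Acyclic _ (σ ∷ T)
  ac′ ¬meet S uS S⊆ S≢[] z with σ ∈? S
  ... | no σ∉S = ac S uS (∉-⊆-tail σ∉S S⊆) S≢[] z
  ... | yes σ∈S with S′ , perm , σ∉S′ , _ ← extract uS σ∈S = contradiction
    (≡.trans (sym (zeroSum⇒even-coboundary sparseOffApex
                    (All.tabulate λ j → All.lookup (proj₁ (∈-cutFaces⁻ i) ∷ fT) (S⊆ j)) z))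
      (≡.trans (xorSum-↭ cut perm)
        (cong₂ _xor_ (proj₂ (∈-cutFaces⁻ i)) (xorSum-vanish cut S′ λ j →
          let j∈T = ∉-⊆-tail σ∉S′ (λ k → S⊆ (∈-resp-↭ (↭-sym perm) (there k))) j
          in ¬-not λ c → ¬meet (lose (∈-cutFaces⁺ (All.lookup fT j∈T) c) j∈T)))))
    λ ()

-- If `C` omits `σ`, a basis of the columns of `σ` and of the faces outside the cut spans every
-- column. It is thus a hypertree, and it misses `C`.
cutFaces-minimal : (C : List (Subset (suc m))) → C ⊆ₗ cutFaces d m →
  MeetsAllHypertrees d C → cutFaces d m ⊆ₗ C
-- Membership in `C` is decidable, which absorbs the double negation of `basis`.
cutFaces-minimal {m} {d} C C⊆ meets {σ} σ∈ = decidable-stable (σ ∈? C) λ σ∉C →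
  basis (σ ∷ flat) (fσ ∷ All.filter⁺ even? (subsets-size (suc m) (suc d)))
    λ { (T , fT , ac , T⊆ , sp) →
      let maximal = λ ρ fρ ρ∉T → span⇒¬acyclic ρ∉T (span-trans sp (spanning ρ fρ))
          x , x∈C , x∈T = find (meets T (fT , ac , maximal))
      in avoids σ∉C x∈C (T⊆ x∈T) }
  where
  even? : (ρ : Subset (suc m)) → Dec (cut ρ ≡ false)
  even? ρ = cut ρ ≟ᵇ false
  flat : List (Subset (suc m))
  flat = filter even? (subsets (suc m) (suc d))
  fσ : IsFace d σ
  fσ = proj₁ (∈-cutFaces⁻ σ∈)
  spanning : ∀ ρ → IsFace d ρ → Span d (_∈ σ ∷ flat) (∂ ρ)
  spanning = span-all (λ {ρ} f c → there (∈-filter⁺ even? (∈-subsets ρ f) c))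
                      fσ (proj₂ (∈-cutFaces⁻ σ∈)) (here refl)
  avoids : σ ∉ C → ∀ {x} → x ∈ C → x ∉ σ ∷ flat
  avoids σ∉C x∈C (here refl) = σ∉C x∈C
  avoids σ∉C x∈C (there j)   = contradiction
    (≡.trans (sym (proj₂ (∈-cutFaces⁻ (C⊆ x∈C)))) (proj₂ (∈-filter⁻ even? {xs = subsets (suc m) (suc d)} j)))
    λ ()

cutFaces-hypercut : {σ : Subset (suc m)} → σ ∈ cutFaces d m → IsHypercut d (cutFaces d m)
cutFaces-hypercut {m} {d} i =
  (Unique.filter⁺ (λ σ → cut σ ≟ᵇ true) (subsets-unique (suc m) (suc d)) ,
   All.filter⁺ (λ σ → cut σ ≟ᵇ true) (subsets-size (suc m) (suc d))) ,
  cutFaces-meets i ,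
  λ C _ → cutFaces-minimal C

-- Counting

-- Sets containing the last element are omitted, which only lowers the count.
sparseSubsets : (n r : ℕ) → List (Subset n)
sparseSubsets zero          zero    = [ [] ]
sparseSubsets zero          (suc r) = []
sparseSubsets (suc n)       zero    = map (outside ∷_) (sparseSubsets n zero)
sparseSubsets (suc zero)    (suc r) = []
sparseSubsets (suc (suc n)) (suc r) =
  map (λ p → inside ∷ outside ∷ p) (sparseSubsets n r) ++ map (outside ∷_) (sparseSubsets (suc n) (suc r))

subsets-outside : (n r : ℕ) → map (outside ∷_) (subsets n r) ⊑ subsets (suc n) r
subsets-outside n zero    = Sub.⊆-refl
subsets-outside n (suc r) = Sub.++⁺ˡ _ Sub.⊆-refl

sparseSubsets-⊑ : (n r : ℕ) → sparseSubsets n r ⊑ subsets n r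
sparseSubsets-⊑ zero          zero    = Sub.⊆-refl
sparseSubsets-⊑ zero          (suc r) = Sub.⊆-refl
sparseSubsets-⊑ (suc n)       zero    = Sub.map⁺ _ (sparseSubsets-⊑ n zero)
sparseSubsets-⊑ (suc zero)    (suc r) = Sub.minimum _
sparseSubsets-⊑ (suc (suc n)) (suc r) = Sub.++⁺
  (subst (_⊑ map (inside ∷_) (subsets (suc n) r)) (sym (map-∘ (sparseSubsets n r)))
    (Sub.map⁺ (inside ∷_) (Sub.⊆-trans (Sub.map⁺ (outside ∷_) (sparseSubsets-⊑ n r)) (subsets-outside n r))))
  (Sub.map⁺ (outside ∷_) (sparseSubsets-⊑ (suc n) (suc r)))

sparseSubsets-sparse : (n r : ℕ) → All (λ p → sparse p ≡ true) (sparseSubsets n r)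
sparseSubsets-sparse zero          zero    = refl ∷ []
sparseSubsets-sparse zero          (suc r) = []
sparseSubsets-sparse (suc n)       zero    = All.map⁺ (sparseSubsets-sparse n zero)
sparseSubsets-sparse (suc zero)    (suc r) = []
sparseSubsets-sparse (suc (suc n)) (suc r) =
  All.++⁺ (All.map⁺ (sparseSubsets-sparse n r)) (All.map⁺ (sparseSubsets-sparse (suc n) (suc r)))

-- The sets counted are arrangements of `r` blocks `inside ∷ outside` and `t ∸ r` single `outside`
-- entries. Branching on the first block is Pascal's rule.
length-sparseSubsets : (t r : ℕ) → t C r ≤ length (sparseSubsets (t + r) r)
length-sparseSubsets t zero = go (t + zero)
  where
  go : ∀ n → 1 ≤ length (sparseSubsets n zero)
  go zero    = ≤-refl
  go (suc n) = subst (1 ≤_) (sym (length-map _ (sparseSubsets n zero))) (go n)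
length-sparseSubsets zero    (suc r) = z≤n
length-sparseSubsets (suc t) (suc r) rewrite +-suc t r = begin
  suc t C suc r        ≡⟨ nCk+nC[k+1]≡[n+1]C[k+1] t r ⟨
  t C r + t C suc r
    ≤⟨ +-mono-≤ (length-sparseSubsets t r)
         (subst (λ k → t C suc r ≤ length (sparseSubsets k (suc r))) (+-suc t r)
                (length-sparseSubsets t (suc r))) ⟩
  length (sparseSubsets (t + r) r) + length (sparseSubsets (suc (t + r)) (suc r))
    ≡⟨ cong₂ _+_ (length-map _ (sparseSubsets (t + r) r))
                 (length-map _ (sparseSubsets (suc (t + r)) (suc r))) ⟨
  length (map in-out (sparseSubsets (t + r) r)) +
  length (map (outside ∷_) (sparseSubsets (suc (t + r)) (suc r)))
    ≡⟨ length-++ (map in-out (sparseSubsets (t + r) r)) ⟨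
  length (sparseSubsets (suc (suc (t + r))) (suc r)) ∎
  where
  open ≤-Reasoning
  in-out : Subset n → Subset (suc (suc n))
  in-out p = inside ∷ outside ∷ p

length-cutFaces : (d t : ℕ) → 2 ∣ d → t C suc d ≤ length (cutFaces d (t + suc d))
length-cutFaces d t 2∣d = begin
  t C suc d              ≤⟨ length-sparseSubsets t (suc d) ⟩
  length sparse-faces    ≡⟨ length-map (outside ∷_) sparse-faces ⟨
  length faces           ≡⟨ cong length (filter-all (λ σ → cut σ ≟ᵇ true) in-cut) ⟨
  length (filter (λ σ → cut σ ≟ᵇ true) faces)
    ≤⟨ Sub.length-mono-≤ (Sub.filter⁺ (λ σ → cut σ ≟ᵇ true) (λ σ → cut σ ≟ᵇ true) (λ { refl c → c }) faces⊑) ⟩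
  length (cutFaces d v)  ∎
  where
  open ≤-Reasoning
  v = t + suc d
  sparse-faces = sparseSubsets v (suc d)
  faces = map (outside ∷_) sparse-faces
  faces⊑ : faces ⊑ subsets (suc v) (suc d)
  faces⊑ = Sub.⊆-trans (Sub.map⁺ (outside ∷_) (sparseSubsets-⊑ v (suc d))) (subsets-outside v (suc d))
  -- All `suc d` facets are sparse, and `suc d` is odd because `d` is even.
  in-cut : All (λ σ → cut σ ≡ true) faces
  in-cut = All.map⁺ (All.map
    (λ { {p} (s , size) → ≡.trans (facetSum-sparse p s)
           (≡.trans (cong odd size) (cong not (2∣⇒even 2∣d))) })
    (All.zip (sparseSubsets-sparse v (suc d) ,
              Sub.All-resp-⊆ (sparseSubsets-⊑ v (suc d)) (subsets-size v (suc d)))))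

-- Binomial estimates

C-monoˡ-suc : ∀ n r → n C r ≤ suc n C r
C-monoˡ-suc n zero    = ≤-refl
C-monoˡ-suc n (suc r) = subst (n C suc r ≤_) (nCk+nC[k+1]≡[n+1]C[k+1] n r) (m≤n+m _ (n C r))

-- The absorption identity: expand by Pascal's rule, set one copy of `x` aside, and apply induction
-- to both remaining terms.
C-absorb : ∀ n r → suc r * (suc n C suc r) ≡ suc n * (n C r)
C-absorb zero    zero    = refl
C-absorb zero    (suc r) = *-zeroʳ (suc (suc r))
C-absorb (suc n) zero    = begin
  1 * (suc (suc n) C 1)          ≡⟨ *-identityˡ _ ⟩
  suc (suc n) C 1                ≡⟨ nC1≡n (suc (suc n)) ⟩
  suc (suc n)                    ≡⟨ *-identityʳ _ ⟨
  suc (suc n) * 1                ∎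
  where open ≡-Reasoning
C-absorb (suc n) (suc r) = begin
  suc (suc r) * (suc (suc n) C suc (suc r))
    ≡⟨ cong (suc (suc r) *_) (nCk+nC[k+1]≡[n+1]C[k+1] (suc n) (suc r)) ⟨
  suc (suc r) * (x + suc n C suc (suc r))
    ≡⟨ *-distribˡ-+ (suc (suc r)) x _ ⟩
  (x + suc r * x) + suc (suc r) * (suc n C suc (suc r))
    ≡⟨ cong₂ (λ a b → (x + a) + b) (C-absorb n r) (C-absorb n (suc r)) ⟩
  (x + suc n * (n C r)) + suc n * (n C suc r)
    ≡⟨ +-assoc x _ _ ⟩
  x + (suc n * (n C r) + suc n * (n C suc r))
    ≡⟨ cong (x +_) (*-distribˡ-+ (suc n) (n C r) _) ⟨
  x + suc n * (n C r + n C suc r)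
    ≡⟨ cong (λ a → x + suc n * a) (nCk+nC[k+1]≡[n+1]C[k+1] n r) ⟩
  x + suc n * x ∎
  where
  open ≡-Reasoning
  x = suc n C suc r

-- Pascal's rule telescoped over `suc j` points; each removal loses at most as many subsets as the
-- first one.
C-drop : ∀ t j r → suc (t + j) C suc r ≤ t C suc r + suc j * ((t + j) C r)
C-drop t zero r rewrite +-identityʳ t | *-identityˡ (t C r) =
  ≤-reflexive (≡.trans (sym (nCk+nC[k+1]≡[n+1]C[k+1] t r)) (+-comm (t C r) _))
C-drop t (suc j) r rewrite +-suc t j = begin
  suc s C suc r                      ≡⟨ nCk+nC[k+1]≡[n+1]C[k+1] s r ⟨
  s C r + s C suc r                  ≤⟨ +-monoʳ-≤ (s C r) (C-drop t j r) ⟩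
  s C r + (t C suc r + suc j * ((t + j) C r))
    ≤⟨ +-monoʳ-≤ (s C r) (+-monoʳ-≤ (t C suc r) (*-monoʳ-≤ (suc j) (C-monoˡ-suc (t + j) r))) ⟩
  s C r + (t C suc r + suc j * (s C r)) ≡⟨ +-assoc (s C r) (t C suc r) _ ⟨
  (s C r + t C suc r) + suc j * (s C r) ≡⟨ cong (_+ suc j * (s C r)) (+-comm (s C r) _) ⟩
  (t C suc r + s C r) + suc j * (s C r) ≡⟨ +-assoc (t C suc r) _ _ ⟩
  t C suc r + (s C r + suc j * (s C r)) ∎
  where
  open ≤-Reasoning
  s = suc (t + j)

-- Removing r + 2 points from n = t + r + 2 loses at most (r + 2) C(n − 1, r) subsets,
-- and n C(n − 1, r) = (r + 1) C(n, r + 1) makes this at most C(n, r + 1) / (k + 1).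
C-density : ∀ k r t → suc k * suc (suc r) * suc r ≤ t →
  k * (suc (t + suc r) C suc r) ≤ suc k * (t C suc r)
C-density k r t big = +-cancelˡ-≤ x _ _ (begin
  suc k * x                     ≤⟨ *-monoʳ-≤ (suc k) (C-drop t (suc r) r) ⟩
  suc k * (t C suc r + j * z)   ≡⟨ *-distribˡ-+ (suc k) (t C suc r) (j * z) ⟩
  suc k * (t C suc r) + suc k * (j * z) ≤⟨ +-monoʳ-≤ _ loss ⟩
  suc k * (t C suc r) + x       ≡⟨ +-comm _ x ⟩
  x + suc k * (t C suc r)       ∎)
  where
  open ≤-Reasoning
  j = suc (suc r)
  x = suc (t + suc r) C suc r
  z = (t + suc r) C r
  loss : suc k * (j * z) ≤ x
  loss = *-cancelˡ-≤ (suc r) (begin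
    suc r * (suc k * (j * z))  ≡⟨ cong (suc r *_) (*-assoc (suc k) j z) ⟨
    suc r * (suc k * j * z)    ≡⟨ *-assoc (suc r) (suc k * j) z ⟨
    suc r * (suc k * j) * z    ≡⟨ cong (_* z) (*-comm (suc r) (suc k * j)) ⟩
    suc k * j * suc r * z      ≤⟨ *-monoˡ-≤ z (≤-trans big (m≤n⇒m≤1+n (m≤m+n t (suc r)))) ⟩
    suc (t + suc r) * z        ≡⟨ C-absorb (t + suc r) r ⟨
    suc r * x                  ∎)

C-positive : ∀ {n r} → r ≤ n → 1 ≤ n C r
C-positive {n}     {r} r≤n with m≤n⇒m<n∨m≡n r≤n
... | inj₂ refl = ≤-reflexive (sym (nCn≡1 n))
C-positive {suc n} {r} _   | inj₁ (s≤s r≤n) = ≤-trans (C-positive r≤n) (C-monoˡ-suc n r)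

theorem6 : (d : ℕ) → 2 ∣ d → 2 ≤ d → (k : ℕ) →
    ∃ λ (N : ℕ) → (n : ℕ) → N ≤ n →
    Σ (List (Subset n)) λ H →
    IsHypercut d H × k * (n C (suc d)) ≤ suc k * length H
-- The vertices are one apex and a path of `t + suc d` vertices with `M ≤ t`, where `M` is the
-- threshold in `C-density` for density k / (k + 1).
theorem6 d 2∣d _ k = suc (M + suc d) , λ n N≤n →
  subst Goal (N+[n∸N]≡n n N≤n) (large (M + (n ∸ suc (M + suc d))) (m≤m+n M _))
  where
  M : ℕ
  M = suc k * suc (suc d) * suc d
  Goal : ℕ → Set
  Goal n = Σ (List (Subset n)) λ H → IsHypercut d H × k * (n C (suc d)) ≤ suc k * length H
  N+[n∸N]≡n : ∀ n → suc (M + suc d) ≤ n → suc (M + (n ∸ suc (M + suc d)) + suc d) ≡ n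
  N+[n∸N]≡n n N≤n = ≡.trans
    (cong suc (≡.trans (+-assoc M _ (suc d))
      (≡.trans (cong (M +_) (+-comm _ (suc d))) (sym (+-assoc M (suc d) _)))))
    (m+[n∸m]≡n N≤n)
  large : ∀ t → M ≤ t → Goal (suc (t + suc d))
  large t M≤t = cutFaces d (t + suc d) , cutFaces-hypercut (proj₂ (nonempty _ 1≤length)) ,
    ≤-trans (C-density k d t M≤t) (*-monoʳ-≤ (suc k) (length-cutFaces d t 2∣d))
    where
    -- The hypercut property needs a face in the cut; the same count supplies it, since `M` is at
    -- least `suc d`.
    1≤length : 1 ≤ length (cutFaces d (t + suc d))
    1≤length = ≤-trans (C-positive (≤-trans (m≤n*m (suc d) (suc k * suc (suc d))) M≤t))
                       (length-cutFaces d t 2∣d)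
    nonempty : {A : Set} (xs : List A) → 1 ≤ length xs → ∃ λ x → x ∈ xs
    nonempty (x ∷ _) _ = x , here refl
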